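{- Let $\Gamma$ be a context, $A$, $C$ formulas, and $x_1,x_2,y$ distinct variables not declared in $\Gamma$. Then $\mathcal{S}(\Gamma,x_1:A,x_2:A\Rightarrow C)=[x_1+x_2/y]\,\mathcal{S}(\Gamma,y:A\Rightarrow C)$.
   Context: Formulas are built from atoms by implication $\supset$ (associating to the right); contexts are finite lists of declarations with distinct variables. Böhm forests and elimination alternatives are generated coinductively by $N::=_{co}\lambda x^A.N\mid E_1+\cdots+E_n$, $E::=_{co}x\langle N_1,\dots,N_k\rangle$ ($n,k\ge0$); equality of Böhm forests is coinductive (bisimilarity) with sums of alternatives treated as sets ($+$ associative, commutative, idempotent, empty sum $\mathbb{O}$ neutral). The solution space is defined corecursively by $\mathcal{S}(\Gamma\Rightarrow A\supset B)=\lambda z^A.\mathcal{S}(\Gamma,z:A\Rightarrow B)$ ($z$ fresh) and $\mathcal{S}(\Gamma\Rightarrow p)=\sum_{(w:B_1\supset\cdots\supset B_k\supset p)\in\Gamma}w\langle\mathcal{S}(\Gamma\Rightarrow B_1),\dots,\mathcal{S}(\Gamma\Rightarrow B_k)\rangle$ for $p$ an atom. The operation $[x_1+\cdots+x_n/y]$ on Böhm forests and elimination alternatives is defined by simultaneous corecursion: $[x_1+\cdots+x_n/y](\lambda z^A.N)=\lambda z^A.[x_1+\cdots+x_n/y]N$; $[x_1+\cdots+x_n/y]\sum_iE_i=\sum_i[x_1+\cdots+x_n/y]E_i$; $[x_1+\cdots+x_n/y](z\langle N_1,\dots,N_k\rangle)=z\langle[\dots]N_1,\dots,[\dots]N_k\rangle$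 if $z\neq y$; $[x_1+\cdots+x_n/y](y\langle N_1,\dots,N_k\rangle)=\sum_{1\le j\le n}x_j\langle[x_1+\cdots+x_n/y]N_1,\dots,[x_1+\cdots+x_n/y]N_k\rangle$. -}

module Defs where

open import Level using (Level; _⊔_) renaming (suc to lsuc)
open import Data.Nat using (ℕ; zero; suc; _≟_)
open import Data.List using (List; []; _∷_; _++_; _∷ʳ_; map; concatMap)
open import Data.Product using (_×_; _,_; proj₁; proj₂; Σ; ∃-syntax)
open import Data.List.Membership.Propositional using (_∈_)
open import Data.List.Relation.Unary.Any using (Any)
open import Data.List.Relation.Binary.Pointwise using (Pointwise)
open import Relation.Binary.PropositionalEquality using (_≡_)
open import Relation.Nullary using (yes; no)

infixr 6 _⊃_
data Form : Set where
  atom : ℕ → Form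
  _⊃_  : Form → Form → Form

args : Form → List Form
args (atom p) = []
args (A ⊃ B)  = A ∷ args B

target : Form → ℕ
target (atom p) = p
target (A ⊃ B)  = target B

Var : Set
Var = ℕ

Ctx : Set
Ctx = List (Var × Form)

dom : Ctx → List Var
dom = map proj₁

-- Coinductive types are not available (the --guardedness / --sized-types
-- flags are forbidden), so the coinductive type of Böhm forests is
-- presented through coalgebras of the signature functor
--     N ::= λx^A.N | E₁ + ⋯ + Eₙ ,   E ::= x⟨N₁,…,Nₖ⟩ :
-- a Böhm forest is a state of some coalgebra; it denotes the tree obtained
-- by unfolding.  Equality of Böhm forests (bisimilarity) is the existence
-- of a bisimulation relating the two roots.
--
-- Variables are represented locally nameless: free variables are names
-- (fv x); a variable bound by a λ inside the forest is a de Bruijn level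
-- (bv k = the variable of the k-th enclosing λ counted from the root).
-- This realises the "z fresh" convention and α-equivalence exactly.

data Head : Set where
  fv : Var → Head
  bv : ℕ → Head

data AltF (X : Set) : Set where
  app : Head → List X → AltF X

data NodeF (X : Set) : Set where
  lam : Form → X → NodeF X
  sum : List (AltF X) → NodeF X

record BF : Set₁ where
  field
    St   : Set
    step : St → NodeF St
    root : St
open BF public

-- Bisimilarity; sums are compared as sets of alternatives
-- (so + is associative, commutative, idempotent, with 𝕆 neutral).

module _ {X Y : Set} (R : X → Y → Set) where

  data AltRel : AltF X → AltF Y → Set where
    app≈ : ∀ {h xs ys} → Pointwise R xs ys → AltRel (app h xs) (app h ys)

  data NodeRel : NodeF X → NodeF Y → Set where
    lam≈ : ∀ {A x y} → R x y → NodeRel (lam A x) (lam A y)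
    sum≈ : ∀ {es fs} →
           (∀ {e} → e ∈ es → Any (AltRel e) fs) →
           (∀ {f} → f ∈ fs → Any (λ e → AltRel e f) es) →
           NodeRel (sum es) (sum fs)

IsBisim : (M N : BF) → (St M → St N → Set) → Set
IsBisim M N R = ∀ {x y} → R x y → NodeRel R (step M x) (step N y)

infix 4 _≈_
_≈_ : BF → BF → Set₁
M ≈ N = Σ (St M → St N → Set) λ R → IsBisim M N R × R (root M) (root N)

-- Solution space.  A state (Γ , Δ , C) stands for the sequent
--   Γ, z₀:Δ₀, …, zₘ₋₁:Δₘ₋₁ ⇒ C
-- where z₀,…,zₘ₋₁ are the fresh variables introduced by the λ's above
-- (levels bv 0, …, bv (m-1)).

SeqSt : Set
SeqSt = Ctx × List Form × Form

altsΓ : Ctx → List Form → ℕ → Ctx → List (AltF SeqSt)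
altsΓ Γ Δ p []             = []
altsΓ Γ Δ p ((w , B) ∷ ds) with target B ≟ p
... | yes _ = app (fv w) (map (λ D → Γ , Δ , D) (args B)) ∷ altsΓ Γ Δ p ds
... | no  _ = altsΓ Γ Δ p ds

altsΔ : Ctx → List Form → ℕ → ℕ → List Form → List (AltF SeqSt)
altsΔ Γ Δ p k []       = []
altsΔ Γ Δ p k (B ∷ Bs) with target B ≟ p
... | yes _ = app (bv k) (map (λ D → Γ , Δ , D) (args B)) ∷ altsΔ Γ Δ p (suc k) Bs
... | no  _ = altsΔ Γ Δ p (suc k) Bs

-- 𝒮(Γ ⇒ A ⊃ B) = λz^A. 𝒮(Γ, z:A ⇒ B)
-- 𝒮(Γ ⇒ p)     = Σ_{(w : B₁⊃⋯⊃Bₖ⊃p) ∈ Γ} w⟨𝒮(Γ ⇒ B₁),…,𝒮(Γ ⇒ Bₖ)⟩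
stepS : SeqSt → NodeF SeqSt
stepS (Γ , Δ , A ⊃ B)  = lam A (Γ , Δ ∷ʳ A , B)
stepS (Γ , Δ , atom p) = sum (altsΓ Γ Δ p Γ ++ altsΔ Γ Δ p 0 Δ)

𝒮 : Ctx → Form → BF
𝒮 Γ C = record { St = SeqSt ; step = stepS ; root = (Γ , [] , C) }

substAlt : {X : Set} → List Var → Var → AltF X → List (AltF X)
substAlt xs y (app (bv k) Ns) = app (bv k) Ns ∷ []
substAlt xs y (app (fv z) Ns) with z ≟ y
... | yes _ = map (λ x → app (fv x) Ns) xs
... | no  _ = app (fv z) Ns ∷ []

substNode : {X : Set} → List Var → Var → NodeF X → NodeF X
substNode xs y (lam A N) = lam A N
substNode xs y (sum es)  = sum (concatMap (substAlt xs y) es)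

subst : List Var → Var → BF → BF
subst xs y M = record { St = St M ; step = λ s → substNode xs y (step M s) ; root = root M }

-- Substitution [x₁ + ⋯ + xₙ / y] only touches alternatives headed by y, and
-- on the single alternative y⟨𝒮(B₁),…,𝒮(Bₖ)⟩ it produces exactly the
-- alternatives x₁⟨…⟩ + ⋯ + xₙ⟨…⟩ contributed by the copies x₁:A,…,xₙ:A.  So at
-- every atomic sequent both forests offer the same heads with the same
-- subgoals, and the relation "same fresh declarations and goal, over the one
-- context or the other" is a bisimulation.
module Submission where

open import Defs
open import Data.List using (List; []; _∷_; _∷ʳ_; _++_; concatMap; map)
open import Data.List.Properties using (++-assoc; ++-identityʳ; concatMap-++)
open import Data.List.Membership.Propositional using (_∈_; _∉_)
open import Data.List.Relation.Unary.Any using (Any; here; there)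
open import Data.List.Relation.Unary.Unique.Propositional using (Unique)
open import Data.List.Relation.Binary.Pointwise as Pointwise using (Pointwise; []; _∷_; ++⁺)
open import Data.Nat using (ℕ; _≟_)
open import Data.Product using (_,_)
open import Function using (_∘_)
open import Relation.Binary.PropositionalEquality
  using (_≡_; _≢_; refl; sym; trans; cong; cong₂; module ≡-Reasoning)
  renaming (subst to ≡-subst)
open import Relation.Nullary using (yes; no; contradiction)

sum≈-pointwise : ∀ {X Y : Set} {R : X → Y → Set} {es fs} →
                 Pointwise (AltRel R) es fs → NodeRel R (sum es) (sum fs)
sum≈-pointwise {R = R} es∼fs = sum≈ (forward es∼fs) (backward es∼fs)
  where
  forward : ∀ {es fs} → Pointwise (AltRel R) es fs →
            ∀ {e} → e ∈ es → Any (AltRel R e) fs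
  forward (e∼f ∷ _)   (here refl) = here e∼f
  forward (_ ∷ es∼fs) (there e∈es) = there (forward es∼fs e∈es)

  backward : ∀ {es fs} → Pointwise (AltRel R) es fs →
             ∀ {f} → f ∈ fs → Any (λ e → AltRel R e f) es
  backward (e∼f ∷ _)   (here refl) = here e∼f
  backward (_ ∷ es∼fs) (there f∈fs) = there (backward es∼fs f∈fs)

altsΓ-++ : ∀ G Δ p ds es → altsΓ G Δ p (ds ++ es) ≡ altsΓ G Δ p ds ++ altsΓ G Δ p es
altsΓ-++ G Δ p []             es = refl
altsΓ-++ G Δ p ((w , B) ∷ ds) es with target B ≟ p
... | yes _ = cong (_ ∷_) (altsΓ-++ G Δ p ds es)
... | no  _ = altsΓ-++ G Δ p ds es

module _ {G : Ctx} {Δ : List Form} {p : ℕ} {A : Form} where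

  altsΓ-copies-matching : target A ≡ p → ∀ xs →
    altsΓ G Δ p (map (_, A) xs) ≡ map (λ x → app (fv x) (map (λ D → G , Δ , D) (args A))) xs
  altsΓ-copies-matching A↦p []       = refl
  altsΓ-copies-matching A↦p (x ∷ xs) with target A ≟ p
  ... | yes _  = cong (_ ∷_) (altsΓ-copies-matching A↦p xs)
  ... | no A↦̸p = contradiction A↦p A↦̸p

  altsΓ-copies-nonmatching : target A ≢ p → ∀ xs → altsΓ G Δ p (map (_, A) xs) ≡ []
  altsΓ-copies-nonmatching A↦̸p []       = refl
  altsΓ-copies-nonmatching A↦̸p (x ∷ xs) with target A ≟ p
  ... | yes A↦p = contradiction A↦p A↦̸p
  ... | no _    = altsΓ-copies-nonmatching A↦̸p xs

module _ (xs : List Var) (y : Var) (G : Ctx) (Δ : List Form) (p : ℕ) where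

  private
    substAlts : List (AltF SeqSt) → List (AltF SeqSt)
    substAlts = concatMap (substAlt xs y)

  substAlts-altsΓ-fresh : ∀ ds → y ∉ dom ds → substAlts (altsΓ G Δ p ds) ≡ altsΓ G Δ p ds
  substAlts-altsΓ-fresh []             _   = refl
  substAlts-altsΓ-fresh ((w , B) ∷ ds) y∉ds with target B ≟ p
  ... | no _ = substAlts-altsΓ-fresh ds (y∉ds ∘ there)
  ... | yes _ with w ≟ y
  ...   | yes refl = contradiction (here refl) y∉ds
  ...   | no _     = cong (_ ∷_) (substAlts-altsΓ-fresh ds (y∉ds ∘ there))

  substAlts-altsΓ-hit : ∀ A → substAlts (altsΓ G Δ p ((y , A) ∷ [])) ≡ altsΓ G Δ p (map (_, A) xs)
  substAlts-altsΓ-hit A with target A ≟ p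
  ... | no A↦̸p = sym (altsΓ-copies-nonmatching A↦̸p xs)
  ... | yes A↦p with y ≟ y
  ...   | yes _  = trans (++-identityʳ _) (sym (altsΓ-copies-matching A↦p xs))
  ...   | no y≢y = contradiction refl y≢y

  substAlts-altsΓ : ∀ Γ A → y ∉ dom Γ →
    substAlts (altsΓ G Δ p (Γ ∷ʳ (y , A))) ≡ altsΓ G Δ p (Γ ++ map (_, A) xs)
  substAlts-altsΓ Γ A y∉Γ = begin
    substAlts (altsΓ G Δ p (Γ ∷ʳ (y , A)))
      ≡⟨ cong substAlts (altsΓ-++ G Δ p Γ _) ⟩
    substAlts (altsΓ G Δ p Γ ++ altsΓ G Δ p ((y , A) ∷ []))
      ≡⟨ concatMap-++ (substAlt xs y) (altsΓ G Δ p Γ) _ ⟩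
    substAlts (altsΓ G Δ p Γ) ++ substAlts (altsΓ G Δ p ((y , A) ∷ []))
      ≡⟨ cong₂ _++_ (substAlts-altsΓ-fresh Γ y∉Γ) (substAlts-altsΓ-hit A) ⟩
    altsΓ G Δ p Γ ++ altsΓ G Δ p (map (_, A) xs)
      ≡⟨ sym (altsΓ-++ G Δ p Γ _) ⟩
    altsΓ G Δ p (Γ ++ map (_, A) xs)
      ∎
    where open ≡-Reasoning

  substAlts-altsΔ : ∀ k Bs → substAlts (altsΔ G Δ p k Bs) ≡ altsΔ G Δ p k Bs
  substAlts-altsΔ k []       = refl
  substAlts-altsΔ k (B ∷ Bs) with target B ≟ p
  ... | yes _ = cong (_ ∷_) (substAlts-altsΔ _ Bs)
  ... | no _  = substAlts-altsΔ _ Bs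

module _ {R : SeqSt → SeqSt → Set} {G G′ : Ctx}
         (related : ∀ {Δ D} → R (G , Δ , D) (G′ , Δ , D)) where

  subgoals-related : ∀ Δ Ds → Pointwise R (map (λ D → G , Δ , D) Ds) (map (λ D → G′ , Δ , D) Ds)
  subgoals-related Δ Ds = Pointwise.map⁺ _ _ (Pointwise.refl related)

  altsΓ-related : ∀ Δ p ds → Pointwise (AltRel R) (altsΓ G Δ p ds) (altsΓ G′ Δ p ds)
  altsΓ-related Δ p []             = []
  altsΓ-related Δ p ((w , B) ∷ ds) with target B ≟ p
  ... | yes _ = app≈ (subgoals-related Δ (args B)) ∷ altsΓ-related Δ p ds
  ... | no _  = altsΓ-related Δ p ds

  altsΔ-related : ∀ Δ p k Bs → Pointwise (AltRel R) (altsΔ G Δ p k Bs) (altsΔ G′ Δ p k Bs)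
  altsΔ-related Δ p k []       = []
  altsΔ-related Δ p k (B ∷ Bs) with target B ≟ p
  ... | yes _ = app≈ (subgoals-related Δ (args B)) ∷ altsΔ-related Δ p _ Bs
  ... | no _  = altsΔ-related Δ p _ Bs

data SameGoal (G G′ : Ctx) : SeqSt → SeqSt → Set where
  same : ∀ Δ C → SameGoal G G′ (G , Δ , C) (G′ , Δ , C)

𝒮-copies≈subst : ∀ Γ A C xs y → y ∉ dom Γ →
                 𝒮 (Γ ++ map (_, A) xs) C ≈ subst xs y (𝒮 (Γ ∷ʳ (y , A)) C)
𝒮-copies≈subst Γ A C xs y y∉Γ = SameGoal G G′ , bisim , same [] C
  where
  G G′ : Ctx
  G  = Γ ++ map (_, A) xs
  G′ = Γ ∷ʳ (y , A)

  bisim : IsBisim (𝒮 G C) (subst xs y (𝒮 G′ C)) (SameGoal G G′)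
  bisim (same Δ (B ⊃ D))  = lam≈ (same (Δ ∷ʳ B) D)
  bisim (same Δ (atom p)) = sum≈-pointwise (≡-subst (Pointwise (AltRel (SameGoal G G′)) _)
                                                     (sym substituted) related)
    where
    related : Pointwise (AltRel (SameGoal G G′))
                (altsΓ G Δ p G ++ altsΔ G Δ p 0 Δ) (altsΓ G′ Δ p G ++ altsΔ G′ Δ p 0 Δ)
    related = ++⁺ (altsΓ-related (same _ _) Δ p G) (altsΔ-related (same _ _) Δ p 0 Δ)

    substituted : concatMap (substAlt xs y) (altsΓ G′ Δ p G′ ++ altsΔ G′ Δ p 0 Δ)
                ≡ altsΓ G′ Δ p G ++ altsΔ G′ Δ p 0 Δ
    substituted = trans (concatMap-++ (substAlt xs y) (altsΓ G′ Δ p G′) (altsΔ G′ Δ p 0 Δ))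
      (cong₂ _++_ (substAlts-altsΓ xs y G′ Δ p Γ A y∉Γ) (substAlts-altsΔ xs y G′ Δ p 0 Δ))

lemma18 : (Γ : Ctx) (A C : Form) (x₁ x₂ y : Var) →
    Unique (dom Γ) →
    x₁ ≢ x₂ → x₁ ≢ y → x₂ ≢ y →
    x₁ ∉ dom Γ → x₂ ∉ dom Γ → y ∉ dom Γ →
    𝒮 (Γ ∷ʳ (x₁ , A) ∷ʳ (x₂ , A)) C
    ≈ subst (x₁ ∷ x₂ ∷ []) y (𝒮 (Γ ∷ʳ (y , A)) C)
lemma18 Γ A C x₁ x₂ y _ _ _ _ _ _ y∉Γ =
  ≡-subst (λ G → 𝒮 G C ≈ subst (x₁ ∷ x₂ ∷ []) y (𝒮 (Γ ∷ʳ (y , A)) C))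
        (sym (++-assoc Γ ((x₁ , A) ∷ []) ((x₂ , A) ∷ [])))
        (𝒮-copies≈subst Γ A C (x₁ ∷ x₂ ∷ []) y y∉Γ)
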